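{- Let $n$ be an odd positive integer and let $h(z)=\sum_{0\leq i\leq n-1}a_iz^i\in\mathbb{F}_2[z]/(z^n-1)$. Then $h(z)=g(z)g^*(z)$ for some $g(z)=\sum_{0\leq i\leq n-1}b_iz^i\in\mathbb{F}_2[z]/(z^n-1)$ if and only if $h(z)$ is symmetric. Furthermore, every symmetric polynomial $h(z)=\sum_{0\leq i\leq n-1}a_iz^i\in\mathbb{F}_2[z]/(z^n-1)$ has a factorization $h(z)=g(z)g^*(z)$ with $$g(z)=\sum_{0\leq i\leq n-1}a_{2i\ (\mathrm{mod}\ n)}z^i.$$
   Context: Elements of $\mathbb{F}_2[z]/(z^n-1)$ are represented by their unique representatives of degree at most $n-1$, and products and equalities are in this ring. For $g(z)=\sum_{0\leq i\leq n-1}b_iz^i\in\mathbb{F}_2[z]/(z^n-1)$, the reciprocal polynomial is $g^*(z)=\sum_{0\leq i\leq n-1}b_iz^{n-i}\pmod{z^n-1}$. A polynomial $\sum_{0\leq i\leq n-1}a_iz^i$ is symmetric if $a_i=a_{n-i}$ for all $1\leq i\leq n-1$. The subscript $2i\ (\mathrm{mod}\ n)$ denotes the residue in $\{0,\ldots,n-1\}$. -}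

module Defs where

open import Algebra.Bundles using (CommutativeRing)
open import Algebra.Bundles.Raw using (RawRing)
open import Data.Fin.Base using (Fin; toℕ)
open import Data.List.Base using (List; []; _∷_; map)
open import Data.Nat.Base using (ℕ; zero; suc; _∸_; _≤_; NonZero)
open import Data.Nat.DivMod using (_mod_)
open import Data.Parity.Properties using (+-*-commutativeRing)
open import Data.Vec.Functional using (Vector)
open import Level using (0ℓ)
open import Relation.Binary.PropositionalEquality.Core using (_≡_; _≗_)
import Algebra.Definitions.RawSemiring as RawSemiringDefinitions
import Data.Nat.Base as ℕ

-- Parity is ℤ/2ℤ; its two elements are 0ℙ and 1ℙ.
module 𝔽₂ = CommutativeRing +-*-commutativeRing

𝔽₂ : Set
𝔽₂ = 𝔽₂.Carrier

-- Coefficient lists, constant term first.  Trailing zeros are allowed, so two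
-- lists are the same polynomial when all their coefficients agree.
Poly : Set
Poly = List 𝔽₂

coeff : Poly → ℕ → 𝔽₂
coeff []      _       = 𝔽₂.0#
coeff (a ∷ p) zero    = a
coeff (a ∷ p) (suc k) = coeff p k

_+ₚ_ : Poly → Poly → Poly
[]      +ₚ q       = q
(a ∷ p) +ₚ []      = a ∷ p
(a ∷ p) +ₚ (b ∷ q) = (a 𝔽₂.+ b) ∷ (p +ₚ q)

_*ₚ_ : Poly → Poly → Poly
[]      *ₚ q = []
(a ∷ p) *ₚ q = map (a 𝔽₂.*_) q +ₚ (𝔽₂.0# ∷ (p *ₚ q))

𝔽₂[z] : RawRing 0ℓ 0ℓ
𝔽₂[z] = record
  { Carrier = Poly
  ; _≈_     = λ p q → coeff p ≗ coeff q
  ; _+_     = _+ₚ_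
  ; _*_     = _*ₚ_
  ; -_      = map (λ a → 𝔽₂.- a)
  ; 0#      = []
  ; 1#      = 𝔽₂.1# ∷ []
  }

open RawRing 𝔽₂[z] public using (_+_; _*_; -_; 1#)
open RawSemiringDefinitions (RawRing.rawSemiring 𝔽₂[z]) public
  using (_^_; _∣_; sum)

constant : 𝔽₂ → Poly
constant a = a ∷ []

z : Poly
z = 𝔽₂.0# ∷ 𝔽₂.1# ∷ []

-- Equality in 𝔽₂[z]/(zⁿ - 1), on arbitrary (not necessarily reduced)
-- polynomials; the product there is the product of 𝔽₂[z] taken up to it.
infix 4 _≈[_]_
_≈[_]_ : Poly → ℕ → Poly → Set
p ≈[ n ] q = (z ^ n + - 1#) ∣ (p + - q)

-- A Vector 𝔽₂ n holds the coefficients of the representative of degree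
-- at most n - 1.
polynomial : ∀ {n} → Vector 𝔽₂ n → Poly
polynomial a = sum (λ i → constant (a i) * z ^ toℕ i)

-- Left unreduced (the term i = 0 is b₀zⁿ), as it is only compared by _≈[ n ]_.
reciprocal : ∀ {n} → Vector 𝔽₂ n → Poly
reciprocal {n} b = sum (λ i → constant (b i) * z ^ (n ∸ toℕ i))

-- For 1 ≤ i ≤ n - 1 also n - i ≤ n - 1, so that _mod_ only casts n - i to Fin n.
Symmetric : ∀ {n} .{{_ : NonZero n}} → Vector 𝔽₂ n → Set
Symmetric {n} a = ∀ (i : Fin n) → 1 ≤ toℕ i → a i ≡ a ((n ∸ toℕ i) mod n)

doubleIndex : ∀ {n} .{{_ : NonZero n}} → Vector 𝔽₂ n → Vector 𝔽₂ n
doubleIndex {n} a i = a ((2 ℕ.* toℕ i) mod n)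

{-# OPTIONS --safe #-}
module Submission where

-- In 𝔽₂[z]/(zⁿ - 1) the map p ↦ p* is substitution of z⁻¹ = zⁿ⁻¹ for z, hence an involutive ring
-- endomorphism; it fixes every norm g g*, and by uniqueness of reduced representatives a norm is
-- symmetric.  Conversely let h be symmetric and b i = a (2i mod n).  Then g is symmetric too, so
-- g g* = g² = Σ b i z²ⁱ because squaring is additive in characteristic 2.  As n is odd, i ↦ 2i permutes
-- the residues mod n, and the last sum is Σ a j zʲ = h.

open import Algebra.Bundles using (CommutativeRing)
open import Algebra.Bundles.Raw using (RawRing)
open import Algebra.Morphism.Construct.Composition using (isRingHomomorphism)
open import Algebra.Morphism.Structures using (IsRingHomomorphism)
open import Data.Fin.Base using (Fin; zero; suc; toℕ)
open import Data.Fin.Permutation using (Permutation′; permutation; _⟨$⟩ʳ_)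
open import Data.Fin.Properties using (toℕ<n; toℕ≤n; toℕ-fromℕ<; toℕ-injective)
open import Data.Nat.Base using (ℕ; zero; suc; NonZero; _%_; _/_; _∸_)
open import Data.Nat.DivMod
import Data.Nat.Base as ℕ
import Data.Nat.Properties as ℕ
open import Data.Product.Base using (_×_; _,_; ∃)
open import Data.Nat.Tactic.RingSolver using (solve-∀)
open import Data.Parity.Properties using (*-idem; p+p≡0ℙ)
open import Data.Vec.Functional using (Vector)
open import Function.Base using (_∘_; id)
open import Function.Bundles using (_⇔_; mk⇔)
open import Relation.Binary.PropositionalEquality as ≡ using (_≡_; _≗_; cong; cong₂; module ≡-Reasoning)

-- The congruence of the statement is divisibility between coefficient lists, an awkward place for
-- rewriting inside sums and powers. Exponents are therefore handled in an arbitrary commutative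
-- ring with an element w such that wⁿ = 1; the quotient with w = z is only one instance. There n -
-- i stands for -i, wᵏ depends on k modulo n alone, and 2 is inverted modulo n by (n + 1)/2, an
-- integer because n is odd. That g² carries the coefficients b i and not their squares is due to b²
-- = b in 𝔽₂. Were p ↦ p* defined on reduced representatives, its multiplicativity would have to be
-- computed with indices modulo n. As an evaluation of unreduced polynomials it is a homomorphism by
-- the general theory, and it descends to the quotient because z⁻¹ is again an nth root of unity.
-- Uniqueness of reduced representatives is the one step that looks at degrees, and so needs
-- concrete coefficients instead of ring laws.

-- Arithmetic of remainders modulo n

toℕ-mod : ∀ m n .{{_ : NonZero n}} → toℕ (m mod n) ≡ m % n
toℕ-mod m n = toℕ-fromℕ< (m%n<n m n)

%-toℕ : ∀ {n} .{{_ : NonZero n}} (i : Fin n) → toℕ i % n ≡ toℕ i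
%-toℕ i = m<n⇒m%n≡m (toℕ<n i)

[m+k%n]%n≡[m+k]%n : ∀ m k n .{{_ : NonZero n}} → (m ℕ.+ k % n) % n ≡ (m ℕ.+ k) % n
[m+k%n]%n≡[m+k]%n m k n = begin
  (m ℕ.+ k % n) % n           ≡⟨ %-distribˡ-+ m (k % n) n ⟩
  (m % n ℕ.+ k % n % n) % n   ≡⟨ cong (λ r → (m % n ℕ.+ r) % n) (m%n%n≡m%n k n) ⟩
  (m % n ℕ.+ k % n) % n       ≡⟨ %-distribˡ-+ m k n ⟨
  (m ℕ.+ k) % n               ∎
  where open ≡-Reasoning

[m*[k%n]]%n≡[m*k]%n : ∀ m k n .{{_ : NonZero n}} → (m ℕ.* (k % n)) % n ≡ (m ℕ.* k) % n
[m*[k%n]]%n≡[m*k]%n m k n = begin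
  (m ℕ.* (k % n)) % n             ≡⟨ %-distribˡ-* m (k % n) n ⟩
  ((m % n) ℕ.* (k % n % n)) % n   ≡⟨ cong (λ r → ((m % n) ℕ.* r) % n) (m%n%n≡m%n k n) ⟩
  ((m % n) ℕ.* (k % n)) % n       ≡⟨ %-distribˡ-* m k n ⟨
  (m ℕ.* k) % n                   ∎
  where open ≡-Reasoning

-- For k ≤ n the truncated difference is exact. Adding m + k, a multiple of n, to n ∸ k therefore
-- changes no remainder, cancels k and leaves m + n.
m+k%n≡0⇒[n∸k]%n≡m%n : ∀ {m k n} .{{_ : NonZero n}} →
                      k ℕ.≤ n → (m ℕ.+ k) % n ≡ 0 → (n ∸ k) % n ≡ m % n
m+k%n≡0⇒[n∸k]%n≡m%n {m} {k} {n} k≤n m+k≡0 = begin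
  (n ∸ k) % n                         ≡⟨ cong (_% n) (ℕ.+-identityʳ (n ∸ k)) ⟨
  (n ∸ k ℕ.+ 0) % n                   ≡⟨ cong (λ r → (n ∸ k ℕ.+ r) % n) m+k≡0 ⟨
  (n ∸ k ℕ.+ (m ℕ.+ k) % n) % n       ≡⟨ [m+k%n]%n≡[m+k]%n (n ∸ k) (m ℕ.+ k) n ⟩
  (n ∸ k ℕ.+ (m ℕ.+ k)) % n           ≡⟨ cong (_% n) (swap (n ∸ k) m k) ⟩
  (m ℕ.+ (n ∸ k ℕ.+ k)) % n           ≡⟨ cong (λ r → (m ℕ.+ r) % n) (ℕ.m∸n+n≡m k≤n) ⟩
  (m ℕ.+ n) % n                       ≡⟨ [m+n]%n≡m%n m n ⟩
  m % n                               ∎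
  where
  open ≡-Reasoning
  swap : ∀ a b c → a ℕ.+ (b ℕ.+ c) ≡ b ℕ.+ (a ℕ.+ c)
  swap = solve-∀

-- Negation and doubling of residues

module _ {n : ℕ} .{{_ : NonZero n}} where

  -- The index map of `Symmetric`. The reduction has an effect at 0 only, where n returns to 0.
  negate : Fin n → Fin n
  negate i = (n ∸ toℕ i) mod n

  double : Fin n → Fin n
  double i = (2 ℕ.* toℕ i) mod n

  toℕ-negate : ∀ i → toℕ (negate i) ≡ (n ∸ toℕ i) % n
  toℕ-negate i = toℕ-mod (n ∸ toℕ i) n

  toℕ-double : ∀ i → toℕ (double i) ≡ (2 ℕ.* toℕ i) % n
  toℕ-double i = toℕ-mod (2 ℕ.* toℕ i) n

  -- Negatives are characterised by their sum with i being 0 modulo n. Involutivity and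
  -- compatibility with doubling then follow without any case distinction on truncated subtraction.
  negate-unique : ∀ i j → (toℕ i ℕ.+ toℕ j) % n ≡ 0 → negate j ≡ i
  negate-unique i j i+j≡0 = toℕ-injective (begin
    toℕ (negate j)    ≡⟨ toℕ-negate j ⟩
    (n ∸ toℕ j) % n   ≡⟨ m+k%n≡0⇒[n∸k]%n≡m%n (toℕ≤n j) i+j≡0 ⟩
    toℕ i % n         ≡⟨ %-toℕ i ⟩
    toℕ i             ∎)
    where open ≡-Reasoning

  negate-inverse : ∀ i → (toℕ i ℕ.+ toℕ (negate i)) % n ≡ 0
  negate-inverse i = begin
    (toℕ i ℕ.+ toℕ (negate i)) % n    ≡⟨ cong (λ r → (toℕ i ℕ.+ r) % n) (toℕ-negate i) ⟩
    (toℕ i ℕ.+ (n ∸ toℕ i) % n) % n   ≡⟨ [m+k%n]%n≡[m+k]%n (toℕ i) (n ∸ toℕ i) n ⟩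
    (toℕ i ℕ.+ (n ∸ toℕ i)) % n       ≡⟨ cong (_% n) (ℕ.m+[n∸m]≡n (toℕ≤n i)) ⟩
    n % n                             ≡⟨ n%n≡0 n ⟩
    0                                 ∎
    where open ≡-Reasoning

  negate-involutive : ∀ i → negate (negate i) ≡ i
  negate-involutive i = negate-unique i (negate i) (negate-inverse i)

  negate-double : ∀ i → negate (double i) ≡ double (negate i)
  negate-double i = negate-unique (double (negate i)) (double i) (begin
    (toℕ (double (negate i)) ℕ.+ toℕ (double i)) % n
      ≡⟨ cong₂ (λ r s → (r ℕ.+ s) % n) (toℕ-double (negate i)) (toℕ-double i) ⟩
    ((2 ℕ.* toℕ (negate i)) % n ℕ.+ (2 ℕ.* toℕ i) % n) % n
      ≡⟨ %-distribˡ-+ (2 ℕ.* toℕ (negate i)) (2 ℕ.* toℕ i) n ⟨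
    (2 ℕ.* toℕ (negate i) ℕ.+ 2 ℕ.* toℕ i) % n
      ≡⟨ cong (_% n) (factor (toℕ (negate i)) (toℕ i)) ⟩
    (2 ℕ.* (toℕ i ℕ.+ toℕ (negate i))) % n
      ≡⟨ [m*[k%n]]%n≡[m*k]%n 2 (toℕ i ℕ.+ toℕ (negate i)) n ⟨
    (2 ℕ.* ((toℕ i ℕ.+ toℕ (negate i)) % n)) % n
      ≡⟨ cong (λ r → (2 ℕ.* r) % n) (negate-inverse i) ⟩
    0 % n
      ≡⟨ m*n%n≡0 0 n ⟩
    0 ∎)
    where
    open ≡-Reasoning
    factor : ∀ a b → 2 ℕ.* a ℕ.+ 2 ℕ.* b ≡ 2 ℕ.* (b ℕ.+ a)
    factor = solve-∀

  negation : Permutation′ n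
  negation = permutation negate negate negate-involutive negate-involutive

  -- For odd n the factor `suc (n / 2)` is (n + 1)/2, the inverse of 2 modulo n.
  half : Fin n → Fin n
  half i = (suc (n / 2) ℕ.* toℕ i) mod n

  toℕ-half : ∀ i → toℕ (half i) ≡ (suc (n / 2) ℕ.* toℕ i) % n
  toℕ-half i = toℕ-mod (suc (n / 2) ℕ.* toℕ i) n

  module _ (n-odd : n % 2 ≡ 1) where

    2*[1+n/2]≡1+n : suc (n / 2) ℕ.* 2 ≡ suc n
    -- The left side computes to 2 + (n / 2) * 2; one unit is the successor in `suc n`, the other is
    -- the remainder of the odd number n.
    2*[1+n/2]≡1+n = cong suc (begin
      suc (n / 2 ℕ.* 2)        ≡⟨ cong (ℕ._+ n / 2 ℕ.* 2) n-odd ⟨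
      n % 2 ℕ.+ n / 2 ℕ.* 2    ≡⟨ m≡m%n+[m/n]*n n 2 ⟨
      n                        ∎)
      where open ≡-Reasoning

    -- Since n + 1 is 1 modulo n, c undoes d. Leaving both factors free covers the two composites of
    -- `double` and `half` at once.
    scale-inverse : ∀ c d → c ℕ.* d ≡ suc n → (i : Fin n) → (c ℕ.* ((d ℕ.* toℕ i) % n)) % n ≡ toℕ i
    scale-inverse c d cd≡1+n i = begin
      (c ℕ.* ((d ℕ.* toℕ i) % n)) % n   ≡⟨ [m*[k%n]]%n≡[m*k]%n c (d ℕ.* toℕ i) n ⟩
      (c ℕ.* (d ℕ.* toℕ i)) % n         ≡⟨ cong (_% n) (ℕ.*-assoc c d (toℕ i)) ⟨
      (c ℕ.* d ℕ.* toℕ i) % n           ≡⟨ cong (λ r → (r ℕ.* toℕ i) % n) cd≡1+n ⟩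
      (toℕ i ℕ.+ n ℕ.* toℕ i) % n       ≡⟨ cong (λ r → (toℕ i ℕ.+ r) % n) (ℕ.*-comm n (toℕ i)) ⟩
      (toℕ i ℕ.+ toℕ i ℕ.* n) % n       ≡⟨ [m+kn]%n≡m%n (toℕ i) (toℕ i) n ⟩
      toℕ i % n                         ≡⟨ %-toℕ i ⟩
      toℕ i                             ∎
      where open ≡-Reasoning

    double-half : ∀ i → double (half i) ≡ i
    double-half i = toℕ-injective (begin
      toℕ (double (half i))                            ≡⟨ toℕ-double (half i) ⟩
      (2 ℕ.* toℕ (half i)) % n                         ≡⟨ cong (λ r → (2 ℕ.* r) % n) (toℕ-half i) ⟩
      (2 ℕ.* ((suc (n / 2) ℕ.* toℕ i) % n)) % n        ≡⟨ scale-inverse 2 (suc (n / 2)) (≡.trans (ℕ.*-comm 2 (suc (n / 2))) 2*[1+n/2]≡1+n) i ⟩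
      toℕ i                                            ∎)
      where open ≡-Reasoning

    half-double : ∀ i → half (double i) ≡ i
    half-double i = toℕ-injective (begin
      toℕ (half (double i))                            ≡⟨ toℕ-half (double i) ⟩
      (suc (n / 2) ℕ.* toℕ (double i)) % n             ≡⟨ cong (λ r → (suc (n / 2) ℕ.* r) % n) (toℕ-double i) ⟩
      (suc (n / 2) ℕ.* ((2 ℕ.* toℕ i) % n)) % n        ≡⟨ scale-inverse (suc (n / 2)) 2 2*[1+n/2]≡1+n i ⟩
      toℕ i                                            ∎)
      where open ≡-Reasoning

    doubling : Permutation′ n
    doubling = permutation double half double-half half-double

-- Power sums at an nth root of unity

module RootOfUnity {c ℓ} (R : CommutativeRing c ℓ) where
  open CommutativeRing R hiding (zero)
  open import Algebra.Properties.CommutativeSemigroup *-commutativeSemigroup using () renaming (interchange to *-interchange; x∙yz≈y∙xz to x*yz≈y*xz)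
  open import Algebra.Properties.Semiring.Exp semiring
  open import Algebra.Properties.Semiring.Sum semiring
  open import Relation.Binary.Reasoning.Setoid setoid

  1^k≈1 : ∀ k → 1# ^ k ≈ 1#
  1^k≈1 zero    = refl
  1^k≈1 (suc k) = trans (*-identityˡ (1# ^ k)) (1^k≈1 k)

  -- Links power sums to the Horner recursion by which polynomials are evaluated below.
  sum-horner : ∀ w {n} (x : Vector Carrier (suc n)) →
               sum (λ i → x i * w ^ toℕ i) ≈ x zero + w * sum (λ i → x (suc i) * w ^ toℕ i)
  sum-horner w {n} x = +-cong (*-identityʳ (x zero)) (begin
    sum (λ i → x (suc i) * (w * w ^ toℕ i))   ≈⟨ sum-cong-≋ {n} (λ i → x*yz≈y*xz (x (suc i)) w (w ^ toℕ i)) ⟩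
    sum (λ i → w * (x (suc i) * w ^ toℕ i))   ≈⟨ *-distribˡ-sum {n} w (λ i → x (suc i) * w ^ toℕ i) ⟨
    w * sum (λ i → x (suc i) * w ^ toℕ i)     ∎)

  -- Induction on the number of summands: commutativity makes the two cross terms equal, so they
  -- cancel in characteristic 2.
  sum-square : (∀ x → x + x ≈ 0#) → ∀ {n} (f : Vector Carrier n) → sum f * sum f ≈ sum (λ i → f i * f i)
  sum-square 2x≈0 {zero}  f = zeroˡ 0#
  sum-square 2x≈0 {suc n} f = begin
    (a + s) * (a + s)                 ≈⟨ distribʳ (a + s) a s ⟩
    a * (a + s) + s * (a + s)         ≈⟨ +-cong (distribˡ a a s) (distribˡ s a s) ⟩
    a * a + a * s + (s * a + s * s)   ≈⟨ +-assoc (a * a) (a * s) (s * a + s * s) ⟩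
    a * a + (a * s + (s * a + s * s)) ≈⟨ +-congˡ (+-assoc (a * s) (s * a) (s * s)) ⟨
    a * a + (a * s + s * a + s * s)   ≈⟨ +-congˡ (+-congʳ (+-congˡ (*-comm s a))) ⟩
    a * a + (a * s + a * s + s * s)   ≈⟨ +-congˡ (+-congʳ (2x≈0 (a * s))) ⟩
    a * a + (0# + s * s)              ≈⟨ +-congˡ (+-identityˡ (s * s)) ⟩
    a * a + s * s                     ≈⟨ +-congˡ (sum-square 2x≈0 (f ∘ suc)) ⟩
    a * a + sum (λ i → f (suc i) * f (suc i)) ∎
    where
    a = f zero
    s = sum (f ∘ suc)

  module _ {n : ℕ} .{{_ : NonZero n}} (w : Carrier) (wⁿ≈1 : w ^ n ≈ 1#) where

    ^-% : ∀ k → w ^ k ≈ w ^ (k % n)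
    ^-% k = begin
      w ^ k                               ≈⟨ ^-congʳ w (m≡m%n+[m/n]*n k n) ⟩
      w ^ (k % n ℕ.+ k / n ℕ.* n)         ≈⟨ ^-homo-* w (k % n) (k / n ℕ.* n) ⟩
      w ^ (k % n) * w ^ (k / n ℕ.* n)     ≈⟨ *-congˡ (^-congʳ w (ℕ.*-comm (k / n) n)) ⟩
      w ^ (k % n) * w ^ (n ℕ.* (k / n))   ≈⟨ *-congˡ (^-assocʳ w n (k / n)) ⟨
      w ^ (k % n) * (w ^ n) ^ (k / n)     ≈⟨ *-congˡ (^-congˡ (k / n) wⁿ≈1) ⟩
      w ^ (k % n) * 1# ^ (k / n)          ≈⟨ *-congˡ (1^k≈1 (k / n)) ⟩
      w ^ (k % n) * 1#                    ≈⟨ *-identityʳ (w ^ (k % n)) ⟩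
      w ^ (k % n)                         ∎

    ^-cong-% : ∀ j k → j % n ≡ k % n → w ^ j ≈ w ^ k
    ^-cong-% j k j≡k = trans (^-% j) (trans (^-congʳ w j≡k) (sym (^-% k)))

    -- With w = z and constant coefficients these become `polynomial` and `reciprocal`.
    ascending descending : Vector Carrier n → Carrier
    ascending  x = sum (λ i → x i * w ^ toℕ i)
    descending x = sum (λ i → x i * w ^ (n ∸ toℕ i))

    -- The exponents e i need only represent the permuted indices modulo n, because wⁿ = 1 absorbs
    -- the reduction. This serves both n - i for negation and 2i for doubling.
    ascending-permute : ∀ x (π : Permutation′ n) (e : Fin n → ℕ) →
                        (∀ i → toℕ (π ⟨$⟩ʳ i) ≡ e i % n) →
                        sum (λ i → x (π ⟨$⟩ʳ i) * w ^ e i) ≈ ascending x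
    ascending-permute x π e π≡e = begin
      sum (λ i → x (π ⟨$⟩ʳ i) * w ^ e i)
        ≈⟨ sum-cong-≋ {n} (λ i → *-congˡ (^-% (e i))) ⟩
      sum (λ i → x (π ⟨$⟩ʳ i) * w ^ (e i % n))
        ≈⟨ sum-cong-≋ {n} (λ i → *-congˡ (^-congʳ w (π≡e i))) ⟨
      sum (λ i → x (π ⟨$⟩ʳ i) * w ^ toℕ (π ⟨$⟩ʳ i))
        ≈⟨ sum-permute (λ i → x i * w ^ toℕ i) π ⟨
      ascending x ∎

    descending≈ascending : ∀ x → descending x ≈ ascending (x ∘ negate)
    descending≈ascending x = begin
      descending x
        ≈⟨ sum-cong-≋ {n} (λ i → *-congʳ (reflexive (cong x (negate-involutive i)))) ⟨
      sum (λ i → x (negate (negate i)) * w ^ (n ∸ toℕ i))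
        ≈⟨ ascending-permute (x ∘ negate) negation (λ i → n ∸ toℕ i) toℕ-negate ⟩
      ascending (x ∘ negate) ∎

    ascending-cong : ∀ {x y : Vector Carrier n} → (∀ i → x i ≈ y i) → ascending x ≈ ascending y
    ascending-cong x≈y = sum-cong-≋ {n} (λ i → *-congʳ (x≈y i))

    -- Without cross terms, squaring doubles each exponent and squares each coefficient; idempotence
    -- removes the latter effect, and reindexing along the permutation `doubling` restores the
    -- original sum.
    ascending-double-square : n % 2 ≡ 1 → (∀ x → x + x ≈ 0#) →
                              ∀ x → (∀ i → x i * x i ≈ x i) →
                              ascending (x ∘ double) * ascending (x ∘ double) ≈ ascending x
    ascending-double-square n-odd 2x≈0 x x²≈x = begin
      ascending (x ∘ double) * ascending (x ∘ double)
        ≈⟨ sum-square 2x≈0 {n} (λ i → x (double i) * w ^ toℕ i) ⟩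
      sum (λ i → (x (double i) * w ^ toℕ i) * (x (double i) * w ^ toℕ i))
        ≈⟨ sum-cong-≋ {n} square ⟩
      sum (λ i → x (double i) * w ^ (2 ℕ.* toℕ i))
        ≈⟨ ascending-permute x (doubling n-odd) (λ i → 2 ℕ.* toℕ i) toℕ-double ⟩
      ascending x ∎
      where
      square : ∀ i → (x (double i) * w ^ toℕ i) * (x (double i) * w ^ toℕ i) ≈ x (double i) * w ^ (2 ℕ.* toℕ i)
      square i = begin
        (x (double i) * w ^ toℕ i) * (x (double i) * w ^ toℕ i)
          ≈⟨ *-interchange (x (double i)) (w ^ toℕ i) (x (double i)) (w ^ toℕ i) ⟩
        (x (double i) * x (double i)) * (w ^ toℕ i * w ^ toℕ i)
          ≈⟨ *-cong (x²≈x (double i)) (sym (^-homo-* w (toℕ i) (toℕ i))) ⟩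
        x (double i) * w ^ (toℕ i ℕ.+ toℕ i)
          -- `2 ℕ.* k` computes to `k ℕ.+ (k ℕ.+ 0)`, hence the correction by a trailing zero.
          ≈⟨ *-congˡ (^-congʳ w (cong (toℕ i ℕ.+_) (ℕ.+-identityʳ (toℕ i)))) ⟨
        x (double i) * w ^ (2 ℕ.* toℕ i) ∎

    -- Negation commutes with doubling, so evenness of x passes to `x ∘ double`. Its descending sum
    -- thus equals its ascending sum, and the norm is a square.
    ascending-double-norm : n % 2 ≡ 1 → (∀ x → x + x ≈ 0#) →
                            ∀ x → (∀ i → x i * x i ≈ x i) → (∀ i → x (negate i) ≈ x i) →
                            ascending x ≈ ascending (x ∘ double) * descending (x ∘ double)
    ascending-double-norm n-odd 2x≈0 x x²≈x x-even = begin
      ascending x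
        ≈⟨ ascending-double-square n-odd 2x≈0 x x²≈x ⟨
      ascending (x ∘ double) * ascending (x ∘ double)
        ≈⟨ *-congˡ (ascending-cong (λ i → x-even (double i))) ⟨
      ascending (x ∘ double) * ascending (x ∘ negate ∘ double)
        ≈⟨ *-congˡ (ascending-cong (λ i → reflexive (cong x (negate-double i)))) ⟩
      ascending (x ∘ double) * ascending (x ∘ double ∘ negate)
        ≈⟨ *-congˡ (descending≈ascending (x ∘ double)) ⟨
      ascending (x ∘ double) * descending (x ∘ double) ∎

    -- As m = n - 1, the product mi plus i is ni, which is 0 modulo n; so mi and n - i are congruent
    -- exponents. The range includes i = n, where the right side is w⁰.
    inverse-^ : ∀ {m} → suc m ≡ n → ∀ i → i ℕ.≤ n → (w ^ m) ^ i ≈ w ^ (n ∸ i)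
    inverse-^ {m} ≡.refl i i≤n = begin
      (w ^ m) ^ i      ≈⟨ ^-assocʳ w m i ⟩
      w ^ (m ℕ.* i)    ≈⟨ ^-cong-% (n ∸ i) (m ℕ.* i) (m+k%n≡0⇒[n∸k]%n≡m%n {m ℕ.* i} i≤n mi+i≡0) ⟨
      w ^ (n ∸ i)      ∎
      where
      mi+i≡0 : (m ℕ.* i ℕ.+ i) % n ≡ 0
      mi+i≡0 = ≡.trans (cong (_% n) (≡.trans (ℕ.+-comm (m ℕ.* i) i) (ℕ.*-comm n i))) (m*n%n≡0 i n)

    inverse-ascending : ∀ {m} → suc m ≡ n → ∀ x → sum (λ i → x i * (w ^ m) ^ toℕ i) ≈ descending x
    inverse-ascending 1+m≡n x = sum-cong-≋ {n} (λ i → *-congˡ (inverse-^ 1+m≡n (toℕ i) (toℕ≤n i)))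

    module _ (φ : Carrier → Carrier) (φ-homo : IsRingHomomorphism rawRing rawRing φ) where
      open IsRingHomomorphism φ-homo using (⟦⟧-cong; *-homo)

      -- Applying φ to x = y y* swaps the two factors on the right and negates the indices on the
      -- left. That φ reverses a sum is assumed for three vectors only, since an evaluation does so
      -- when the coefficients are constants. The third vector, `y ∘ negate`, gives the image of
      -- `descending y`.
      norm-even : ∀ {x y} → φ (ascending x) ≈ descending x → φ (ascending y) ≈ descending y →
                  φ (ascending (y ∘ negate)) ≈ descending (y ∘ negate) →
                  ascending x ≈ ascending y * descending y → ascending (x ∘ negate) ≈ ascending x
      norm-even {x} {y} φx φy φy⁻ x≈yy* = begin
        ascending (x ∘ negate)              ≈⟨ descending≈ascending x ⟨
        descending x                        ≈⟨ φx ⟨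
        φ (ascending x)                     ≈⟨ ⟦⟧-cong x≈yy* ⟩
        φ (ascending y * descending y)      ≈⟨ *-homo (ascending y) (descending y) ⟩
        φ (ascending y) * φ (descending y)  ≈⟨ *-cong φy φ-descending ⟩
        descending y * ascending y          ≈⟨ *-comm (descending y) (ascending y) ⟩
        ascending y * descending y          ≈⟨ x≈yy* ⟨
        ascending x                         ∎
        where
        φ-descending : φ (descending y) ≈ ascending y
        φ-descending = begin
          φ (descending y)                    ≈⟨ ⟦⟧-cong (descending≈ascending y) ⟩
          φ (ascending (y ∘ negate))          ≈⟨ φy⁻ ⟩
          descending (y ∘ negate)             ≈⟨ descending≈ascending (y ∘ negate) ⟩
          ascending (y ∘ negate ∘ negate)     ≈⟨ ascending-cong (λ i → reflexive (cong y (negate-involutive i))) ⟩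
          ascending y                         ∎

-- The quotient of a commutative ring by a principal ideal

module PrincipalQuotient {c ℓ} (R : CommutativeRing c ℓ) (m : CommutativeRing.Carrier R) where
  open CommutativeRing R hiding (zero)
  open import Algebra.Definitions.RawMagma *-rawMagma using (_∣_; _,_)
  open import Algebra.Properties.AbelianGroup +-abelianGroup using (⁻¹-∙-comm; ⁻¹-anti-homo‿-; x≈y⇒x∙y⁻¹≈ε)
  open import Algebra.Properties.CommutativeSemigroup +-commutativeSemigroup using (interchange)
  open import Algebra.Properties.CommutativeSemigroup *-commutativeSemigroup using (xy∙z≈xz∙y)
  open import Algebra.Properties.Ring ring using ([y-z]x≈yx-zx; -‿distribˡ-*)
  open import Relation.Binary.Reasoning.Setoid setoid

  infix 4 _≋_
  -- For polynomials and m = zⁿ - 1 this unfolds to `_≈[ n ]_`, so facts about the quotient ring are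
  -- literally facts about the congruence of the statement.
  _≋_ : Carrier → Carrier → Set _
  x ≋ y = m ∣ (x + - y)

  ≈⇒≋ : ∀ {x y} → x ≈ y → x ≋ y
  ≈⇒≋ x≈y = 0# , trans (zeroˡ m) (sym (x≈y⇒x∙y⁻¹≈ε x≈y))

  ≋-sym : ∀ {x y} → x ≋ y → y ≋ x
  ≋-sym {x} {y} (q , qm≈x-y) = - q , (begin
    - q * m      ≈⟨ -‿distribˡ-* q m ⟨
    - (q * m)    ≈⟨ -‿cong qm≈x-y ⟩
    - (x + - y)  ≈⟨ ⁻¹-anti-homo‿- x y ⟩
    y + - x      ∎)

  ≋-trans : ∀ {x y z} → x ≋ y → y ≋ z → x ≋ z
  ≋-trans {x} {y} {z} (p , pm≈x-y) (q , qm≈y-z) = p + q , (begin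
    (p + q) * m              ≈⟨ distribʳ m p q ⟩
    p * m + q * m            ≈⟨ +-cong pm≈x-y qm≈y-z ⟩
    (x + - y) + (y + - z)    ≈⟨ +-assoc x (- y) (y + - z) ⟩
    x + (- y + (y + - z))    ≈⟨ +-congˡ (+-assoc (- y) y (- z)) ⟨
    x + ((- y + y) + - z)    ≈⟨ +-congˡ (+-congʳ (-‿inverseˡ y)) ⟩
    x + (0# + - z)           ≈⟨ +-congˡ (+-identityˡ (- z)) ⟩
    x + - z                  ∎)

  +-cong-≋ : ∀ {x y u v} → x ≋ y → u ≋ v → x + u ≋ y + v
  +-cong-≋ {x} {y} {u} {v} (p , pm≈x-y) (q , qm≈u-v) = p + q , (begin
    (p + q) * m              ≈⟨ distribʳ m p q ⟩
    p * m + q * m            ≈⟨ +-cong pm≈x-y qm≈u-v ⟩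
    (x + - y) + (u + - v)    ≈⟨ interchange x (- y) u (- v) ⟩
    (x + u) + (- y + - v)    ≈⟨ +-congˡ (⁻¹-∙-comm y v) ⟩
    (x + u) + - (y + v)      ∎)

  -‿cong-≋ : ∀ {x y} → x ≋ y → - x ≋ - y
  -‿cong-≋ {x} {y} (q , qm≈x-y) = - q , (begin
    - q * m        ≈⟨ -‿distribˡ-* q m ⟨
    - (q * m)      ≈⟨ -‿cong qm≈x-y ⟩
    - (x + - y)    ≈⟨ ⁻¹-∙-comm x (- y) ⟨
    - x + - - y    ∎)

  *-congʳ-≋ : ∀ {x y z} → x ≋ y → x * z ≋ y * z
  *-congʳ-≋ {x} {y} {z} (q , qm≈x-y) = q * z , (begin
    q * z * m          ≈⟨ xy∙z≈xz∙y q z m ⟩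
    q * m * z          ≈⟨ *-congʳ qm≈x-y ⟩
    (x + - y) * z      ≈⟨ [y-z]x≈yx-zx z x y ⟩
    x * z + - (y * z)  ∎)

  *-cong-≋ : ∀ {x y u v} → x ≋ y → u ≋ v → x * u ≋ y * v
  *-cong-≋ {x} {y} {u} {v} x≋y u≋v =
    ≋-trans (*-congʳ-≋ x≋y) (≋-trans (≈⇒≋ (*-comm y u)) (≋-trans (*-congʳ-≋ u≋v) (≈⇒≋ (*-comm v y))))

  quotient : CommutativeRing c _
  quotient = record
    { Carrier = Carrier
    ; _≈_ = _≋_
    ; _+_ = _+_
    ; _*_ = _*_
    ; -_  = -_
    ; 0#  = 0#
    ; 1#  = 1#
    ; isCommutativeRing = record
      { isRing = record
        { +-isAbelianGroup = record
          { isGroup = record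
            { isMonoid = record
              { isSemigroup = record
                { isMagma = record
                  { isEquivalence = record { refl = ≈⇒≋ refl ; sym = ≋-sym ; trans = ≋-trans }
                  ; ∙-cong = +-cong-≋
                  }
                ; assoc = λ x y z → ≈⇒≋ (+-assoc x y z)
                }
              ; identity = (λ x → ≈⇒≋ (+-identityˡ x)) , (λ x → ≈⇒≋ (+-identityʳ x))
              }
            ; inverse = (λ x → ≈⇒≋ (-‿inverseˡ x)) , (λ x → ≈⇒≋ (-‿inverseʳ x))
            ; ⁻¹-cong = -‿cong-≋
            }
          ; comm = λ x y → ≈⇒≋ (+-comm x y)
          }
        ; *-cong = *-cong-≋
        ; *-assoc = λ x y z → ≈⇒≋ (*-assoc x y z)
        ; *-identity = (λ x → ≈⇒≋ (*-identityˡ x)) , (λ x → ≈⇒≋ (*-identityʳ x))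
        ; distrib = (λ x y z → ≈⇒≋ (distribˡ x y z)) , (λ x y z → ≈⇒≋ (distribʳ x y z))
        }
      ; *-comm = λ x y → ≈⇒≋ (*-comm x y)
      }
    }

  -- The quotient keeps the carrier and only coarsens equality, so the projection is the identity
  -- function.
  projection-homo : IsRingHomomorphism rawRing (CommutativeRing.rawRing quotient) id
  projection-homo = record
    { isSemiringHomomorphism = record
      { isNearSemiringHomomorphism = record
        { +-isMonoidHomomorphism = record
          { isMagmaHomomorphism = record
            { isRelHomomorphism = record { cong = ≈⇒≋ }
            ; homo = λ x y → ≈⇒≋ refl
            }
          ; ε-homo = ≈⇒≋ refl
          }
        ; *-homo = λ x y → ≈⇒≋ refl
        }
      ; 1#-homo = ≈⇒≋ refl
      }
    ; -‿homo = λ x → ≈⇒≋ refl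
    }

-- Homomorphisms out of the quotient

module QuotientHomomorphism
  {c ℓ c′ ℓ′} (R : CommutativeRing c ℓ) (m : CommutativeRing.Carrier R) (S : CommutativeRing c′ ℓ′)
  {f : CommutativeRing.Carrier R → CommutativeRing.Carrier S}
  (f-homo : IsRingHomomorphism (CommutativeRing.rawRing R) (CommutativeRing.rawRing S) f)
  where
  private
    module R = CommutativeRing R
    module S = CommutativeRing S
  open PrincipalQuotient R m using (_≋_; quotient)
  open import Algebra.Definitions.RawMagma R.*-rawMagma using (_,_)
  open import Algebra.Properties.Group S.+-group using (x∙y⁻¹≈ε⇒x≈y)
  open import Relation.Binary.Reasoning.Setoid S.setoid
  open IsRingHomomorphism f-homo using (⟦⟧-cong; +-homo; *-homo; -‿homo; 0#-homo; 1#-homo)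

  -- Universal property of the quotient: if x - y = q m, then f x - f y = f q f m = 0.
  quotient-homo : f m S.≈ S.0# → IsRingHomomorphism (CommutativeRing.rawRing quotient) S.rawRing f
  quotient-homo fm≈0 = record
    { isSemiringHomomorphism = record
      { isNearSemiringHomomorphism = record
        { +-isMonoidHomomorphism = record
          { isMagmaHomomorphism = record
            { isRelHomomorphism = record { cong = f-cong-≋ }
            ; homo = +-homo
            }
          ; ε-homo = 0#-homo
          }
        ; *-homo = *-homo
        }
      ; 1#-homo = 1#-homo
      }
    ; -‿homo = -‿homo
    }
    where
    f-cong-≋ : ∀ {x y} → x ≋ y → f x S.≈ f y
    f-cong-≋ {x} {y} (q , qm≈x-y) = x∙y⁻¹≈ε⇒x≈y (f x) (f y) (begin
      f x S.+ S.- f y      ≈⟨ S.+-congˡ (-‿homo y) ⟨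
      f x S.+ f (R.- y)    ≈⟨ +-homo x (R.- y) ⟨
      f (x R.+ R.- y)      ≈⟨ ⟦⟧-cong qm≈x-y ⟨
      f (q R.* m)          ≈⟨ *-homo q m ⟩
      f q S.* f m          ≈⟨ S.*-congˡ fm≈0 ⟩
      f q S.* S.0#         ≈⟨ S.zeroʳ (f q) ⟩
      S.0#                 ∎)

-- Coefficient lists form a commutative ring

open import Defs
open import Data.List.Base using ([]; _∷_; length; map; tabulate)

coeff-+ : ∀ p q k → coeff (p + q) k ≡ coeff p k 𝔽₂.+ coeff q k
coeff-+ []      q       k       = ≡.refl
coeff-+ (a ∷ p) []      k       = ≡.sym (𝔽₂.+-identityʳ (coeff (a ∷ p) k))
coeff-+ (a ∷ p) (b ∷ q) zero    = ≡.refl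
coeff-+ (a ∷ p) (b ∷ q) (suc k) = coeff-+ p q k

coeff-scale : ∀ a p k → coeff (map (a 𝔽₂.*_) p) k ≡ a 𝔽₂.* coeff p k
coeff-scale a []      k       = ≡.sym (𝔽₂.zeroʳ a)
coeff-scale a (b ∷ p) zero    = ≡.refl
coeff-scale a (b ∷ p) (suc k) = coeff-scale a p k

coeff-neg : ∀ p k → coeff (- p) k ≡ 𝔽₂.- coeff p k
coeff-neg []      k       = ≡.refl
coeff-neg (a ∷ p) zero    = ≡.refl
coeff-neg (a ∷ p) (suc k) = coeff-neg p k

coeff-∷-* : ∀ a p q k → coeff ((a ∷ p) * q) k ≡ a 𝔽₂.* coeff q k 𝔽₂.+ coeff (𝔽₂.0# ∷ p * q) k
coeff-∷-* a p q k = ≡.trans (coeff-+ (map (a 𝔽₂.*_) q) (𝔽₂.0# ∷ p * q) k)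
                            (cong (𝔽₂._+ coeff (𝔽₂.0# ∷ p * q) k) (coeff-scale a q k))

∷-cong : ∀ a {p q} → coeff p ≗ coeff q → coeff (a ∷ p) ≗ coeff (a ∷ q)
∷-cong a p≗q zero    = ≡.refl
∷-cong a p≗q (suc k) = p≗q k

coeff-0∷[] : ∀ k → coeff (𝔽₂.0# ∷ []) k ≡ 𝔽₂.0#
coeff-0∷[] zero    = ≡.refl
coeff-0∷[] (suc k) = ≡.refl

coeff-0∷-+ : ∀ p q k → coeff (𝔽₂.0# ∷ p + q) k ≡ coeff (𝔽₂.0# ∷ p) k 𝔽₂.+ coeff (𝔽₂.0# ∷ q) k
coeff-0∷-+ p q zero    = ≡.refl
coeff-0∷-+ p q (suc k) = coeff-+ p q k

coeff-0∷-scale : ∀ a p k → coeff (𝔽₂.0# ∷ map (a 𝔽₂.*_) p) k ≡ a 𝔽₂.* coeff (𝔽₂.0# ∷ p) k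
coeff-0∷-scale a p zero    = ≡.sym (𝔽₂.zeroʳ a)
coeff-0∷-scale a p (suc k) = coeff-scale a p k

open import Algebra.Properties.CommutativeSemigroup 𝔽₂.+-commutativeSemigroup using (interchange; x∙yz≈y∙xz)

*-zeroʳ : ∀ p k → coeff (p * []) k ≡ 𝔽₂.0#
*-zeroʳ []      k       = ≡.refl
*-zeroʳ (a ∷ p) zero    = ≡.refl
*-zeroʳ (a ∷ p) (suc k) = *-zeroʳ p k

-- Mirror image of the defining recursion, which runs on the left factor; commutativity is then a
-- plain induction.
*-∷ʳ : ∀ p b q k → coeff (p * (b ∷ q)) k ≡ b 𝔽₂.* coeff p k 𝔽₂.+ coeff (𝔽₂.0# ∷ p * q) k
*-∷ʳ []      b q zero    = ≡.sym (≡.trans (𝔽₂.+-identityʳ (b 𝔽₂.* 𝔽₂.0#)) (𝔽₂.zeroʳ b))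
*-∷ʳ []      b q (suc k) = ≡.sym (≡.trans (𝔽₂.+-identityʳ (b 𝔽₂.* 𝔽₂.0#)) (𝔽₂.zeroʳ b))
*-∷ʳ (a ∷ p) b q zero    = cong (𝔽₂._+ 𝔽₂.0#) (𝔽₂.*-comm a b)
*-∷ʳ (a ∷ p) b q (suc k) = begin
  coeff ((a ∷ p) * (b ∷ q)) (suc k)
    ≡⟨ coeff-∷-* a p (b ∷ q) (suc k) ⟩
  a 𝔽₂.* coeff q k 𝔽₂.+ coeff (p * (b ∷ q)) k
    ≡⟨ cong (a 𝔽₂.* coeff q k 𝔽₂.+_) (*-∷ʳ p b q k) ⟩
  a 𝔽₂.* coeff q k 𝔽₂.+ (b 𝔽₂.* coeff p k 𝔽₂.+ coeff (𝔽₂.0# ∷ p * q) k)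
    ≡⟨ x∙yz≈y∙xz (a 𝔽₂.* coeff q k) (b 𝔽₂.* coeff p k) (coeff (𝔽₂.0# ∷ p * q) k) ⟩
  b 𝔽₂.* coeff p k 𝔽₂.+ (a 𝔽₂.* coeff q k 𝔽₂.+ coeff (𝔽₂.0# ∷ p * q) k)
    ≡⟨ cong (b 𝔽₂.* coeff p k 𝔽₂.+_) (coeff-∷-* a p q k) ⟨
  b 𝔽₂.* coeff p k 𝔽₂.+ coeff ((a ∷ p) * q) k ∎
  where open ≡-Reasoning

*-comm : ∀ p q → coeff (p * q) ≗ coeff (q * p)
*-comm []      q k = ≡.sym (*-zeroʳ q k)
*-comm (a ∷ p) q k = begin
  coeff ((a ∷ p) * q) k                                  ≡⟨ coeff-∷-* a p q k ⟩
  a 𝔽₂.* coeff q k 𝔽₂.+ coeff (𝔽₂.0# ∷ p * q) k          ≡⟨ cong (a 𝔽₂.* coeff q k 𝔽₂.+_) (∷-cong 𝔽₂.0# (*-comm p q) k) ⟩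
  a 𝔽₂.* coeff q k 𝔽₂.+ coeff (𝔽₂.0# ∷ q * p) k          ≡⟨ *-∷ʳ q a p k ⟨
  coeff (q * (a ∷ p)) k                                  ∎
  where open ≡-Reasoning

-- Only the right factor varies, so the recursion on p applies directly. Equal polynomials may be
-- lists of different lengths, and reaching the left factor through commutativity avoids comparing
-- them entry by entry.
*-congˡ : ∀ p {q r} → coeff q ≗ coeff r → coeff (p * q) ≗ coeff (p * r)
*-congˡ []              q≗r k = ≡.refl
*-congˡ (a ∷ p) {q} {r} q≗r k = begin
  coeff ((a ∷ p) * q) k                           ≡⟨ coeff-∷-* a p q k ⟩
  a 𝔽₂.* coeff q k 𝔽₂.+ coeff (𝔽₂.0# ∷ p * q) k   ≡⟨ 𝔽₂.+-cong (cong (a 𝔽₂.*_) (q≗r k)) (∷-cong 𝔽₂.0# (*-congˡ p q≗r) k) ⟩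
  a 𝔽₂.* coeff r k 𝔽₂.+ coeff (𝔽₂.0# ∷ p * r) k   ≡⟨ coeff-∷-* a p r k ⟨
  coeff ((a ∷ p) * r) k                           ∎
  where open ≡-Reasoning

*-cong : ∀ {p q r s} → coeff p ≗ coeff q → coeff r ≗ coeff s → coeff (p * r) ≗ coeff (q * s)
*-cong {p} {q} {r} {s} p≗q r≗s k = begin
  coeff (p * r) k   ≡⟨ *-congˡ p r≗s k ⟩
  coeff (p * s) k   ≡⟨ *-comm p s k ⟩
  coeff (s * p) k   ≡⟨ *-congˡ s p≗q k ⟩
  coeff (s * q) k   ≡⟨ *-comm s q k ⟩
  coeff (q * s) k   ∎
  where open ≡-Reasoning

*-distribˡ-+ : ∀ p q r → coeff (p * (q + r)) ≗ coeff (p * q + p * r)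
*-distribˡ-+ []      q r k = ≡.refl
*-distribˡ-+ (a ∷ p) q r k = begin
  coeff ((a ∷ p) * (q + r)) k
    ≡⟨ coeff-∷-* a p (q + r) k ⟩
  a 𝔽₂.* coeff (q + r) k 𝔽₂.+ coeff (𝔽₂.0# ∷ p * (q + r)) k
    ≡⟨ 𝔽₂.+-cong (cong (a 𝔽₂.*_) (coeff-+ q r k)) (∷-cong 𝔽₂.0# (*-distribˡ-+ p q r) k) ⟩
  a 𝔽₂.* (coeff q k 𝔽₂.+ coeff r k) 𝔽₂.+ coeff (𝔽₂.0# ∷ p * q + p * r) k
    ≡⟨ 𝔽₂.+-cong (𝔽₂.distribˡ a (coeff q k) (coeff r k)) (coeff-0∷-+ (p * q) (p * r) k) ⟩
  (a 𝔽₂.* coeff q k 𝔽₂.+ a 𝔽₂.* coeff r k) 𝔽₂.+ (coeff (𝔽₂.0# ∷ p * q) k 𝔽₂.+ coeff (𝔽₂.0# ∷ p * r) k)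
    ≡⟨ interchange (a 𝔽₂.* coeff q k) (a 𝔽₂.* coeff r k) (coeff (𝔽₂.0# ∷ p * q) k) (coeff (𝔽₂.0# ∷ p * r) k) ⟩
  (a 𝔽₂.* coeff q k 𝔽₂.+ coeff (𝔽₂.0# ∷ p * q) k) 𝔽₂.+ (a 𝔽₂.* coeff r k 𝔽₂.+ coeff (𝔽₂.0# ∷ p * r) k)
    ≡⟨ 𝔽₂.+-cong (coeff-∷-* a p q k) (coeff-∷-* a p r k) ⟨
  coeff ((a ∷ p) * q) k 𝔽₂.+ coeff ((a ∷ p) * r) k
    ≡⟨ coeff-+ ((a ∷ p) * q) ((a ∷ p) * r) k ⟨
  coeff ((a ∷ p) * q + (a ∷ p) * r) k ∎
  where open ≡-Reasoning

+-cong : ∀ {p q r s} → coeff p ≗ coeff q → coeff r ≗ coeff s → coeff (p + r) ≗ coeff (q + s)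
+-cong {p} {q} {r} {s} p≗q r≗s k = begin
  coeff (p + r) k                ≡⟨ coeff-+ p r k ⟩
  coeff p k 𝔽₂.+ coeff r k       ≡⟨ 𝔽₂.+-cong (p≗q k) (r≗s k) ⟩
  coeff q k 𝔽₂.+ coeff s k       ≡⟨ coeff-+ q s k ⟨
  coeff (q + s) k                ∎
  where open ≡-Reasoning

*-distribʳ-+ : ∀ p q r → coeff ((q + r) * p) ≗ coeff (q * p + r * p)
*-distribʳ-+ p q r k = begin
  coeff ((q + r) * p) k        ≡⟨ *-comm (q + r) p k ⟩
  coeff (p * (q + r)) k        ≡⟨ *-distribˡ-+ p q r k ⟩
  coeff (p * q + p * r) k      ≡⟨ +-cong {p * q} {q * p} {p * r} {r * p} (*-comm p q) (*-comm p r) k ⟩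
  coeff (q * p + r * p) k      ∎
  where open ≡-Reasoning

0∷-* : ∀ p q → coeff ((𝔽₂.0# ∷ p) * q) ≗ coeff (𝔽₂.0# ∷ p * q)
0∷-* p q k = ≡.trans (coeff-∷-* 𝔽₂.0# p q k) (cong (𝔽₂._+ coeff (𝔽₂.0# ∷ p * q) k) (𝔽₂.zeroˡ (coeff q k)))

scale-* : ∀ a p q → coeff (map (a 𝔽₂.*_) p * q) ≗ coeff (map (a 𝔽₂.*_) (p * q))
scale-* a []      q k = ≡.refl
scale-* a (b ∷ p) q k = begin
  coeff (map (a 𝔽₂.*_) (b ∷ p) * q) k
    ≡⟨ coeff-∷-* (a 𝔽₂.* b) (map (a 𝔽₂.*_) p) q k ⟩
  (a 𝔽₂.* b) 𝔽₂.* coeff q k 𝔽₂.+ coeff (𝔽₂.0# ∷ map (a 𝔽₂.*_) p * q) k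
    ≡⟨ 𝔽₂.+-cong (𝔽₂.*-assoc a b (coeff q k)) (∷-cong 𝔽₂.0# (scale-* a p q) k) ⟩
  a 𝔽₂.* (b 𝔽₂.* coeff q k) 𝔽₂.+ coeff (𝔽₂.0# ∷ map (a 𝔽₂.*_) (p * q)) k
    ≡⟨ cong (a 𝔽₂.* (b 𝔽₂.* coeff q k) 𝔽₂.+_) (coeff-0∷-scale a (p * q) k) ⟩
  a 𝔽₂.* (b 𝔽₂.* coeff q k) 𝔽₂.+ a 𝔽₂.* coeff (𝔽₂.0# ∷ p * q) k
    ≡⟨ 𝔽₂.distribˡ a (b 𝔽₂.* coeff q k) (coeff (𝔽₂.0# ∷ p * q) k) ⟨
  a 𝔽₂.* (b 𝔽₂.* coeff q k 𝔽₂.+ coeff (𝔽₂.0# ∷ p * q) k)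
    ≡⟨ cong (a 𝔽₂.*_) (coeff-∷-* b p q k) ⟨
  a 𝔽₂.* coeff ((b ∷ p) * q) k
    ≡⟨ coeff-scale a ((b ∷ p) * q) k ⟨
  coeff (map (a 𝔽₂.*_) ((b ∷ p) * q)) k ∎
  where open ≡-Reasoning

*-assoc : ∀ p q r → coeff ((p * q) * r) ≗ coeff (p * (q * r))
*-assoc []      q r k = ≡.refl
*-assoc (a ∷ p) q r k = begin
  coeff ((map (a 𝔽₂.*_) q + (𝔽₂.0# ∷ p * q)) * r) k
    ≡⟨ *-distribʳ-+ r (map (a 𝔽₂.*_) q) (𝔽₂.0# ∷ p * q) k ⟩
  coeff (map (a 𝔽₂.*_) q * r + (𝔽₂.0# ∷ p * q) * r) k
    ≡⟨ coeff-+ (map (a 𝔽₂.*_) q * r) ((𝔽₂.0# ∷ p * q) * r) k ⟩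
  coeff (map (a 𝔽₂.*_) q * r) k 𝔽₂.+ coeff ((𝔽₂.0# ∷ p * q) * r) k
    ≡⟨ 𝔽₂.+-cong (scale-* a q r k) (0∷-* (p * q) r k) ⟩
  coeff (map (a 𝔽₂.*_) (q * r)) k 𝔽₂.+ coeff (𝔽₂.0# ∷ (p * q) * r) k
    ≡⟨ cong (coeff (map (a 𝔽₂.*_) (q * r)) k 𝔽₂.+_) (∷-cong 𝔽₂.0# (*-assoc p q r) k) ⟩
  coeff (map (a 𝔽₂.*_) (q * r)) k 𝔽₂.+ coeff (𝔽₂.0# ∷ p * (q * r)) k
    ≡⟨ coeff-+ (map (a 𝔽₂.*_) (q * r)) (𝔽₂.0# ∷ p * (q * r)) k ⟨
  coeff ((a ∷ p) * (q * r)) k ∎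
  where open ≡-Reasoning

constant-* : ∀ a p k → coeff (constant a * p) k ≡ a 𝔽₂.* coeff p k
constant-* a p k = begin
  coeff (constant a * p) k                       ≡⟨ coeff-∷-* a [] p k ⟩
  a 𝔽₂.* coeff p k 𝔽₂.+ coeff (𝔽₂.0# ∷ []) k     ≡⟨ cong (a 𝔽₂.* coeff p k 𝔽₂.+_) (coeff-0∷[] k) ⟩
  a 𝔽₂.* coeff p k 𝔽₂.+ 𝔽₂.0#                    ≡⟨ 𝔽₂.+-identityʳ (a 𝔽₂.* coeff p k) ⟩
  a 𝔽₂.* coeff p k                               ∎
  where open ≡-Reasoning

*-identityˡ : ∀ p → coeff (1# * p) ≗ coeff p
*-identityˡ p k = ≡.trans (constant-* 𝔽₂.1# p k) (𝔽₂.*-identityˡ (coeff p k))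

z* : ∀ p → coeff (z * p) ≗ coeff (𝔽₂.0# ∷ p)
z* p k = ≡.trans (0∷-* 1# p k) (∷-cong 𝔽₂.0# (*-identityˡ p) k)

𝔽₂[z]-ring : CommutativeRing _ _
𝔽₂[z]-ring = record
  { RawRing 𝔽₂[z]
  ; isCommutativeRing = record
    { isRing = record
      { +-isAbelianGroup = record
        { isGroup = record
          { isMonoid = record
            { isSemigroup = record
              { isMagma = record
                { isEquivalence = record
                  { refl  = λ _ → ≡.refl
                  ; sym   = λ p≗q k → ≡.sym (p≗q k)
                  ; trans = λ p≗q q≗r k → ≡.trans (p≗q k) (q≗r k)
                  }
                ; ∙-cong = λ {p} {q} {r} {s} → +-cong {p} {q} {r} {s}
                }
              ; assoc = +-assoc
              }
            ; identity = (λ p k → ≡.refl) , +-identityʳ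
            }
          ; inverse = (λ p k → ≡.trans (+-comm (- p) p k) (-‿inverseʳ p k)) , -‿inverseʳ
          ; ⁻¹-cong = λ {p} {q} → -‿cong {p} {q}
          }
        ; comm = +-comm
        }
      ; *-cong = λ {p} {q} {r} {s} → *-cong {p} {q} {r} {s}
      ; *-assoc = *-assoc
      ; *-identity = *-identityˡ , (λ p k → ≡.trans (*-comm p 1# k) (*-identityˡ p k))
      ; distrib = *-distribˡ-+ , *-distribʳ-+
      }
    ; *-comm = *-comm
    }
  }
  where
  open ≡-Reasoning
  +-assoc : ∀ p q r → coeff ((p + q) + r) ≗ coeff (p + (q + r))
  +-assoc p q r k = begin
    coeff ((p + q) + r) k                               ≡⟨ coeff-+ (p + q) r k ⟩
    coeff (p + q) k 𝔽₂.+ coeff r k                      ≡⟨ cong (𝔽₂._+ coeff r k) (coeff-+ p q k) ⟩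
    (coeff p k 𝔽₂.+ coeff q k) 𝔽₂.+ coeff r k           ≡⟨ 𝔽₂.+-assoc (coeff p k) (coeff q k) (coeff r k) ⟩
    coeff p k 𝔽₂.+ (coeff q k 𝔽₂.+ coeff r k)           ≡⟨ cong (coeff p k 𝔽₂.+_) (coeff-+ q r k) ⟨
    coeff p k 𝔽₂.+ coeff (q + r) k                      ≡⟨ coeff-+ p (q + r) k ⟨
    coeff (p + (q + r)) k                               ∎
  +-comm : ∀ p q → coeff (p + q) ≗ coeff (q + p)
  +-comm p q k = begin
    coeff (p + q) k               ≡⟨ coeff-+ p q k ⟩
    coeff p k 𝔽₂.+ coeff q k      ≡⟨ 𝔽₂.+-comm (coeff p k) (coeff q k) ⟩
    coeff q k 𝔽₂.+ coeff p k      ≡⟨ coeff-+ q p k ⟨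
    coeff (q + p) k               ∎
  +-identityʳ : ∀ p → coeff (p + []) ≗ coeff p
  +-identityʳ p k = ≡.trans (coeff-+ p [] k) (𝔽₂.+-identityʳ (coeff p k))
  -‿inverseʳ : ∀ p k → coeff (p + - p) k ≡ 𝔽₂.0#
  -‿inverseʳ p k = begin
    coeff (p + - p) k                   ≡⟨ coeff-+ p (- p) k ⟩
    coeff p k 𝔽₂.+ coeff (- p) k        ≡⟨ cong (coeff p k 𝔽₂.+_) (coeff-neg p k) ⟩
    coeff p k 𝔽₂.+ 𝔽₂.- coeff p k       ≡⟨ 𝔽₂.-‿inverseʳ (coeff p k) ⟩
    𝔽₂.0#                               ∎
  -‿cong : ∀ {p q} → coeff p ≗ coeff q → coeff (- p) ≗ coeff (- q)
  -‿cong {p} {q} p≗q k = begin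
    coeff (- p) k       ≡⟨ coeff-neg p k ⟩
    𝔽₂.- coeff p k      ≡⟨ cong 𝔽₂.-_ (p≗q k) ⟩
    𝔽₂.- coeff q k      ≡⟨ coeff-neg q k ⟨
    coeff (- q) k       ∎

-- Evaluation of polynomials in a commutative ring

module Evaluation
  {c ℓ} (R : CommutativeRing c ℓ) (ι : 𝔽₂ → CommutativeRing.Carrier R)
  (ι-homo : IsRingHomomorphism 𝔽₂.rawRing (CommutativeRing.rawRing R) ι)
  (w : CommutativeRing.Carrier R)
  where
  private
    module R = CommutativeRing R
    module ι = IsRingHomomorphism ι-homo
  open import Algebra.Properties.AbelianGroup R.+-abelianGroup using (⁻¹-∙-comm; x≈y⇒x∙y⁻¹≈ε; ε⁻¹≈ε)
  open import Algebra.Properties.CommutativeSemigroup R.+-commutativeSemigroup using () renaming (interchange to R-interchange)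
  open import Algebra.Properties.CommutativeSemigroup R.*-commutativeSemigroup using () renaming (x∙yz≈y∙xz to x*yz≈y*xz)
  open import Algebra.Properties.Ring R.ring using (-‿distribʳ-*)
  open import Algebra.Properties.Semiring.Exp R.semiring using () renaming (_^_ to _^ᴿ_)
  open import Algebra.Properties.Semiring.Sum R.semiring using () renaming (sum to sumᴿ)
  open import Relation.Binary.Reasoning.Setoid R.setoid

  -- Used at two points: at z in 𝔽₂[z], to read off the coefficients of a power sum, and at z⁻¹ in
  -- the quotient, to obtain p ↦ p*.
  evaluate : Poly → R.Carrier
  evaluate []      = R.0#
  evaluate (a ∷ p) = ι a R.+ w R.* evaluate p

  -- Trailing zeros must not affect the value; this settles the cases of `evaluate-cong` in which
  -- one list ends before the other.
  evaluate-0 : ∀ p → coeff p ≗ coeff [] → evaluate p R.≈ R.0#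
  evaluate-0 []      p≗0 = R.refl
  evaluate-0 (a ∷ p) p≗0 = begin
    ι a R.+ w R.* evaluate p    ≈⟨ R.+-cong (ι.⟦⟧-cong (p≗0 0)) (R.*-congˡ (evaluate-0 p (p≗0 ∘ suc))) ⟩
    ι 𝔽₂.0# R.+ w R.* R.0#      ≈⟨ R.+-cong ι.0#-homo (R.zeroʳ w) ⟩
    R.0# R.+ R.0#               ≈⟨ R.+-identityˡ R.0# ⟩
    R.0#                        ∎

  evaluate-cong : ∀ p q → coeff p ≗ coeff q → evaluate p R.≈ evaluate q
  evaluate-cong []      q       p≗q = R.sym (evaluate-0 q (≡.sym ∘ p≗q))
  evaluate-cong (a ∷ p) []      p≗q = evaluate-0 (a ∷ p) p≗q
  evaluate-cong (a ∷ p) (b ∷ q) p≗q =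
    R.+-cong (ι.⟦⟧-cong (p≗q 0)) (R.*-congˡ (evaluate-cong p q (p≗q ∘ suc)))

  evaluate-+ : ∀ p q → evaluate (p + q) R.≈ evaluate p R.+ evaluate q
  evaluate-+ []      q       = R.sym (R.+-identityˡ (evaluate q))
  evaluate-+ (a ∷ p) []      = R.sym (R.+-identityʳ (evaluate (a ∷ p)))
  evaluate-+ (a ∷ p) (b ∷ q) = begin
    ι (a 𝔽₂.+ b) R.+ w R.* evaluate (p + q)
      ≈⟨ R.+-cong (ι.+-homo a b) (R.*-congˡ (evaluate-+ p q)) ⟩
    (ι a R.+ ι b) R.+ w R.* (evaluate p R.+ evaluate q)
      ≈⟨ R.+-congˡ (R.distribˡ w (evaluate p) (evaluate q)) ⟩
    (ι a R.+ ι b) R.+ (w R.* evaluate p R.+ w R.* evaluate q)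
      ≈⟨ R-interchange (ι a) (ι b) (w R.* evaluate p) (w R.* evaluate q) ⟩
    (ι a R.+ w R.* evaluate p) R.+ (ι b R.+ w R.* evaluate q) ∎

  evaluate-neg : ∀ p → evaluate (- p) R.≈ R.- evaluate p
  evaluate-neg []      = R.sym ε⁻¹≈ε
  evaluate-neg (a ∷ p) = begin
    ι (𝔽₂.- a) R.+ w R.* evaluate (- p)      ≈⟨ R.+-cong (ι.-‿homo a) (R.*-congˡ (evaluate-neg p)) ⟩
    R.- ι a R.+ w R.* R.- evaluate p         ≈⟨ R.+-congˡ (-‿distribʳ-* w (evaluate p)) ⟨
    R.- ι a R.+ R.- (w R.* evaluate p)       ≈⟨ ⁻¹-∙-comm (ι a) (w R.* evaluate p) ⟩
    R.- (ι a R.+ w R.* evaluate p)           ∎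

  evaluate-scale : ∀ a p → evaluate (map (a 𝔽₂.*_) p) R.≈ ι a R.* evaluate p
  evaluate-scale a []      = R.sym (R.zeroʳ (ι a))
  evaluate-scale a (b ∷ p) = begin
    ι (a 𝔽₂.* b) R.+ w R.* evaluate (map (a 𝔽₂.*_) p)
      ≈⟨ R.+-cong (ι.*-homo a b) (R.*-congˡ (evaluate-scale a p)) ⟩
    ι a R.* ι b R.+ w R.* (ι a R.* evaluate p)
      ≈⟨ R.+-congˡ (x*yz≈y*xz w (ι a) (evaluate p)) ⟩
    ι a R.* ι b R.+ ι a R.* (w R.* evaluate p)
      ≈⟨ R.distribˡ (ι a) (ι b) (w R.* evaluate p) ⟨
    ι a R.* (ι b R.+ w R.* evaluate p) ∎

  evaluate-0∷ : ∀ p → evaluate (𝔽₂.0# ∷ p) R.≈ w R.* evaluate p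
  evaluate-0∷ p = R.trans (R.+-congʳ ι.0#-homo) (R.+-identityˡ (w R.* evaluate p))

  evaluate-* : ∀ p q → evaluate (p * q) R.≈ evaluate p R.* evaluate q
  evaluate-* []      q = R.sym (R.zeroˡ (evaluate q))
  evaluate-* (a ∷ p) q = begin
    evaluate (map (a 𝔽₂.*_) q + (𝔽₂.0# ∷ p * q))
      ≈⟨ evaluate-+ (map (a 𝔽₂.*_) q) (𝔽₂.0# ∷ p * q) ⟩
    evaluate (map (a 𝔽₂.*_) q) R.+ evaluate (𝔽₂.0# ∷ p * q)
      ≈⟨ R.+-cong (evaluate-scale a q) (evaluate-0∷ (p * q)) ⟩
    ι a R.* evaluate q R.+ w R.* evaluate (p * q)
      ≈⟨ R.+-congˡ (R.*-congˡ (evaluate-* p q)) ⟩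
    ι a R.* evaluate q R.+ w R.* (evaluate p R.* evaluate q)
      ≈⟨ R.+-congˡ (R.*-assoc w (evaluate p) (evaluate q)) ⟨
    ι a R.* evaluate q R.+ w R.* evaluate p R.* evaluate q
      ≈⟨ R.distribʳ (evaluate q) (ι a) (w R.* evaluate p) ⟨
    (ι a R.+ w R.* evaluate p) R.* evaluate q ∎

  evaluate-1 : evaluate 1# R.≈ R.1#
  evaluate-1 = begin
    ι 𝔽₂.1# R.+ w R.* R.0#    ≈⟨ R.+-cong ι.1#-homo (R.zeroʳ w) ⟩
    R.1# R.+ R.0#             ≈⟨ R.+-identityʳ R.1# ⟩
    R.1#                      ∎

  evaluate-homo : IsRingHomomorphism 𝔽₂[z] R.rawRing evaluate
  evaluate-homo = record
    { isSemiringHomomorphism = record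
      { isNearSemiringHomomorphism = record
        { +-isMonoidHomomorphism = record
          { isMagmaHomomorphism = record
            { isRelHomomorphism = record { cong = λ {p} {q} → evaluate-cong p q }
            ; homo = evaluate-+
            }
          ; ε-homo = R.refl
          }
        ; *-homo = evaluate-*
        }
      ; 1#-homo = evaluate-1
      }
    ; -‿homo = evaluate-neg
    }

  evaluate-z^ : ∀ k → evaluate (z ^ k) R.≈ w ^ᴿ k
  evaluate-z^ zero    = evaluate-1
  evaluate-z^ (suc k) = begin
    evaluate (z * z ^ k)               ≈⟨ evaluate-* z (z ^ k) ⟩
    evaluate z R.* evaluate (z ^ k)    ≈⟨ R.*-cong evaluate-z (evaluate-z^ k) ⟩
    w R.* (w ^ᴿ k)                     ∎
    where
    evaluate-z : evaluate z R.≈ w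
    evaluate-z = R.trans (evaluate-0∷ 1#) (R.trans (R.*-congˡ evaluate-1) (R.*-identityʳ w))

  -- The condition under which evaluation at w descends to the quotient by zⁿ - 1.
  evaluate-zⁿ-1 : ∀ n → w ^ᴿ n R.≈ R.1# → evaluate (z ^ n + - 1#) R.≈ R.0#
  evaluate-zⁿ-1 n wⁿ≈1 = begin
    evaluate (z ^ n + - 1#)                      ≈⟨ evaluate-+ (z ^ n) (- 1#) ⟩
    evaluate (z ^ n) R.+ evaluate (- 1#)         ≈⟨ R.+-cong (evaluate-z^ n) (evaluate-neg 1#) ⟩
    (w ^ᴿ n) R.+ R.- evaluate 1#                 ≈⟨ x≈y⇒x∙y⁻¹≈ε (R.trans wⁿ≈1 (R.sym evaluate-1)) ⟩
    R.0#                                         ∎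

  evaluate-tabulate : ∀ {n} (a : Vector 𝔽₂ n) → evaluate (tabulate a) R.≈ sumᴿ (λ i → ι (a i) R.* (w ^ᴿ toℕ i))
  evaluate-tabulate {zero}  a = R.refl
  evaluate-tabulate {suc n} a = begin
    ι (a zero) R.+ w R.* evaluate (tabulate (a ∘ suc))
      ≈⟨ R.+-congˡ (R.*-congˡ (evaluate-tabulate (a ∘ suc))) ⟩
    ι (a zero) R.+ w R.* sumᴿ (λ i → ι (a (suc i)) R.* (w ^ᴿ toℕ i))
      ≈⟨ RootOfUnity.sum-horner R w (ι ∘ a) ⟨
    sumᴿ (λ i → ι (a i) R.* (w ^ᴿ toℕ i)) ∎

-- Coefficients of reduced representatives

constant-homo : IsRingHomomorphism 𝔽₂.rawRing 𝔽₂[z] constant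
constant-homo = record
  { isSemiringHomomorphism = record
    { isNearSemiringHomomorphism = record
      { +-isMonoidHomomorphism = record
        { isMagmaHomomorphism = record
          { isRelHomomorphism = record { cong = λ { ≡.refl k → ≡.refl } }
          ; homo = λ a b k → ≡.refl
          }
        ; ε-homo = coeff-0∷[]
        }
      ; *-homo = constant-homo-*
      }
    ; 1#-homo = λ k → ≡.refl
    }
  ; -‿homo = λ a k → ≡.refl
  }
  where
  constant-homo-* : ∀ a b → coeff (constant (a 𝔽₂.* b)) ≗ coeff (constant a * constant b)
  constant-homo-* a b zero    = ≡.sym (𝔽₂.+-identityʳ (a 𝔽₂.* b))
  constant-homo-* a b (suc k) = ≡.refl

-- Both sides are the value of the list `tabulate a` at z: evaluation expands it into the power sum,
-- while substituting z for z changes nothing.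
polynomial≗tabulate : ∀ {n} (a : Vector 𝔽₂ n) → coeff (polynomial a) ≗ coeff (tabulate a)
polynomial≗tabulate a k = ≡.trans (≡.sym (evaluate-tabulate a k)) (evaluate-at-z (tabulate a) k)
  where
  open Evaluation 𝔽₂[z]-ring constant constant-homo z
  evaluate-at-z : ∀ p → coeff (evaluate p) ≗ coeff p
  evaluate-at-z []      k = ≡.refl
  evaluate-at-z (a ∷ p) k = begin
    coeff (constant a + z * evaluate p) k                 ≡⟨ coeff-+ (constant a) (z * evaluate p) k ⟩
    coeff (constant a) k 𝔽₂.+ coeff (z * evaluate p) k    ≡⟨ cong (coeff (constant a) k 𝔽₂.+_) (≡.trans (z* (evaluate p) k) (∷-cong 𝔽₂.0# (evaluate-at-z p) k)) ⟩
    coeff (constant a) k 𝔽₂.+ coeff (𝔽₂.0# ∷ p) k         ≡⟨ coeff-+ (constant a) (𝔽₂.0# ∷ p) k ⟨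
    coeff ((a 𝔽₂.+ 𝔽₂.0#) ∷ p) k                          ≡⟨ cong (λ b → coeff (b ∷ p) k) (𝔽₂.+-identityʳ a) ⟩
    coeff (a ∷ p) k                                       ∎
    where open ≡-Reasoning

coeff-tabulate : ∀ {n} (a : Vector 𝔽₂ n) i → coeff (tabulate a) (toℕ i) ≡ a i
coeff-tabulate a zero    = ≡.refl
coeff-tabulate a (suc i) = coeff-tabulate (a ∘ suc) i

coeff-tabulate-≥ : ∀ {n} (a : Vector 𝔽₂ n) k → coeff (tabulate a) (n ℕ.+ k) ≡ 𝔽₂.0#
coeff-tabulate-≥ {zero}  a k = ≡.refl
coeff-tabulate-≥ {suc n} a k = coeff-tabulate-≥ (a ∘ suc) k

-- Multiples of zⁿ - 1 and uniqueness of reduced representatives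

coeff-length≤ : ∀ p {k} → length p ℕ.≤ k → coeff p k ≡ 𝔽₂.0#
coeff-length≤ []      _             = ≡.refl
coeff-length≤ (a ∷ p) (ℕ.s≤s p≤k)   = coeff-length≤ p p≤k

coeff-zⁿ* : ∀ n p k → coeff (z ^ n * p) (n ℕ.+ k) ≡ coeff p k
coeff-zⁿ* zero    p k = *-identityˡ p k
coeff-zⁿ* (suc n) p k = begin
  coeff (z * z ^ n * p) (suc n ℕ.+ k)     ≡⟨ *-assoc z (z ^ n) p (suc n ℕ.+ k) ⟩
  coeff (z * (z ^ n * p)) (suc n ℕ.+ k)   ≡⟨ z* (z ^ n * p) (suc n ℕ.+ k) ⟩
  coeff (z ^ n * p) (n ℕ.+ k)             ≡⟨ coeff-zⁿ* n p k ⟩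
  coeff p k                               ∎
  where open ≡-Reasoning

coeff-*[zⁿ-1] : ∀ n q k → coeff (q * (z ^ n + - 1#)) (n ℕ.+ k) ≡ coeff q k 𝔽₂.+ 𝔽₂.- coeff q (n ℕ.+ k)
coeff-*[zⁿ-1] n q k = begin
  coeff (q * (z ^ n + - 1#)) (n ℕ.+ k)
    ≡⟨ *-comm q (z ^ n + - 1#) (n ℕ.+ k) ⟩
  coeff ((z ^ n + - 1#) * q) (n ℕ.+ k)
    ≡⟨ *-distribʳ-+ q (z ^ n) (- 1#) (n ℕ.+ k) ⟩
  coeff (z ^ n * q + - 1# * q) (n ℕ.+ k)
    ≡⟨ coeff-+ (z ^ n * q) (- 1# * q) (n ℕ.+ k) ⟩
  coeff (z ^ n * q) (n ℕ.+ k) 𝔽₂.+ coeff (- 1# * q) (n ℕ.+ k)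
    ≡⟨ 𝔽₂.+-cong (coeff-zⁿ* n q k) (≡.trans (-1*x≈-x q (n ℕ.+ k)) (coeff-neg q (n ℕ.+ k))) ⟩
  coeff q k 𝔽₂.+ 𝔽₂.- coeff q (n ℕ.+ k) ∎
  where
  open ≡-Reasoning
  open import Algebra.Properties.Ring (CommutativeRing.ring 𝔽₂[z]-ring) using (-1*x≈-x)

open import Algebra.Definitions.RawMagma (CommutativeRing.*-rawMagma 𝔽₂[z]-ring) using (_,_)
open import Algebra.Properties.Group 𝔽₂.+-group using (x∙y⁻¹≈ε⇒x≈y)

module _ {n : ℕ} .{{_ : NonZero n}} where

  -- Comparing coefficients in degrees ≥ n, the cofactor of zⁿ - 1 is n-periodic; being finite, it vanishes.
  multiple-of-zⁿ-1-of-small-degree : ∀ p → (z ^ n + - 1#) ∣ p → (∀ k → coeff p (n ℕ.+ k) ≡ 𝔽₂.0#) → coeff p ≗ coeff []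
  multiple-of-zⁿ-1-of-small-degree p (q , qm≗p) p-small k = begin
    coeff p k                        ≡⟨ qm≗p k ⟨
    coeff (q * (z ^ n + - 1#)) k     ≡⟨ *-cong {q} {[]} {z ^ n + - 1#} {z ^ n + - 1#} q≗0 (λ _ → ≡.refl) k ⟩
    𝔽₂.0#                            ∎
    where
    open ≡-Reasoning
    periodic : ∀ k → coeff q k ≡ coeff q (n ℕ.+ k)
    periodic k = x∙y⁻¹≈ε⇒x≈y (coeff q k) (coeff q (n ℕ.+ k))
      (≡.trans (≡.sym (coeff-*[zⁿ-1] n q k)) (≡.trans (qm≗p (n ℕ.+ k)) (p-small k)))
    periods : ∀ j k → coeff q k ≡ coeff q (j ℕ.* n ℕ.+ k)
    periods zero    k = ≡.refl
    periods (suc j) k = begin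
      coeff q k                            ≡⟨ periods j k ⟩
      coeff q (j ℕ.* n ℕ.+ k)              ≡⟨ periodic (j ℕ.* n ℕ.+ k) ⟩
      coeff q (n ℕ.+ (j ℕ.* n ℕ.+ k))      ≡⟨ cong (coeff q) (ℕ.+-assoc n (j ℕ.* n) k) ⟨
      coeff q (suc j ℕ.* n ℕ.+ k)          ∎
    q≗0 : coeff q ≗ coeff []
    q≗0 k = ≡.trans (periods (length q) k)
      (coeff-length≤ q (ℕ.≤-trans (ℕ.m≤m*n (length q) n) (ℕ.m≤m+n (length q ℕ.* n) k)))

  -- The difference of two reduced representatives has no coefficient in degree n or above, so as a
  -- multiple of zⁿ - 1 it must be zero.
  polynomial-injective : ∀ {a b : Vector 𝔽₂ n} → polynomial a ≈[ n ] polynomial b → a ≗ b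
  polynomial-injective {a} {b} a≈b i = x∙y⁻¹≈ε⇒x≈y (a i) (b i) (begin
    a i 𝔽₂.+ 𝔽₂.- b i                                                        ≡⟨ 𝔽₂.+-cong (coeff-tabulate a i) (cong 𝔽₂.-_ (coeff-tabulate b i)) ⟨
    coeff (tabulate a) (toℕ i) 𝔽₂.+ 𝔽₂.- coeff (tabulate b) (toℕ i)          ≡⟨ coeff-difference (toℕ i) ⟨
    coeff (polynomial a + - polynomial b) (toℕ i)                            ≡⟨ multiple-of-zⁿ-1-of-small-degree (polynomial a + - polynomial b) a≈b small (toℕ i) ⟩
    𝔽₂.0#                                                                    ∎)
    where
    open ≡-Reasoning
    coeff-difference : ∀ k → coeff (polynomial a + - polynomial b) k ≡ coeff (tabulate a) k 𝔽₂.+ 𝔽₂.- coeff (tabulate b) k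
    coeff-difference k = begin
      coeff (polynomial a + - polynomial b) k                     ≡⟨ coeff-+ (polynomial a) (- polynomial b) k ⟩
      coeff (polynomial a) k 𝔽₂.+ coeff (- polynomial b) k        ≡⟨ cong (coeff (polynomial a) k 𝔽₂.+_) (coeff-neg (polynomial b) k) ⟩
      coeff (polynomial a) k 𝔽₂.+ 𝔽₂.- coeff (polynomial b) k     ≡⟨ 𝔽₂.+-cong (polynomial≗tabulate a k) (cong 𝔽₂.-_ (polynomial≗tabulate b k)) ⟩
      coeff (tabulate a) k 𝔽₂.+ 𝔽₂.- coeff (tabulate b) k         ∎
    small : ∀ k → coeff (polynomial a + - polynomial b) (n ℕ.+ k) ≡ 𝔽₂.0#
    small k = begin
      coeff (polynomial a + - polynomial b) (n ℕ.+ k)                             ≡⟨ coeff-difference (n ℕ.+ k) ⟩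
      coeff (tabulate a) (n ℕ.+ k) 𝔽₂.+ 𝔽₂.- coeff (tabulate b) (n ℕ.+ k)         ≡⟨ 𝔽₂.+-cong (coeff-tabulate-≥ a k) (cong 𝔽₂.-_ (coeff-tabulate-≥ b k)) ⟩
      𝔽₂.0# 𝔽₂.+ 𝔽₂.- 𝔽₂.0#                                                       ≡⟨ 𝔽₂.-‿inverseʳ 𝔽₂.0# ⟩
      𝔽₂.0#                                                                       ∎

-- `Symmetric` says nothing about index 0, but 0 is its own negative.
symmetric⇒even : ∀ {n} .{{_ : NonZero n}} {a : Vector 𝔽₂ n} → Symmetric a → ∀ i → a (negate i) ≡ a i
symmetric⇒even {suc n} {a} sym zero    = cong a (negate-unique zero zero ≡.refl)
symmetric⇒even {suc n} {a} sym (suc i) = ≡.sym (sym (suc i) (ℕ.s≤s ℕ.z≤n))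

-- Norms in 𝔽₂[z]/(zⁿ - 1)

module _ (n : ℕ) .{{_ : NonZero n}} where

  open PrincipalQuotient 𝔽₂[z]-ring (z ^ n + - 1#) using (≈⇒≋; quotient; projection-homo)

  𝔽₂[z]/zⁿ-1 : CommutativeRing _ _
  𝔽₂[z]/zⁿ-1 = quotient

  private module Q = CommutativeRing 𝔽₂[z]/zⁿ-1

  open RootOfUnity 𝔽₂[z]/zⁿ-1

  open import Algebra.Properties.Semiring.Exp Q.semiring using () renaming (_^_ to _^ᵠ_)
  open import Algebra.Properties.Semiring.Sum Q.semiring using (sum-cong-≗)

  -- Not definitional: the library's power function depends on the whole raw bundle, including its equality.
  ^ᵠ≡^ : ∀ p k → p ^ᵠ k ≡ p ^ k
  ^ᵠ≡^ p zero    = ≡.refl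
  ^ᵠ≡^ p (suc k) = cong (p *_) (^ᵠ≡^ p k)

  zⁿ≈1 : z ^ᵠ n ≈[ n ] 1#
  zⁿ≈1 = ≡.subst (_≈[ n ] 1#) (≡.sym (^ᵠ≡^ z n)) (1# , *-identityˡ (z ^ n + - 1#))

  ascending≡polynomial : ∀ a → ascending z zⁿ≈1 (constant ∘ a) ≡ polynomial a
  ascending≡polynomial a = sum-cong-≗ {n} (λ i → cong (constant (a i) *_) (^ᵠ≡^ z (toℕ i)))

  descending≡reciprocal : ∀ a → descending z zⁿ≈1 (constant ∘ a) ≡ reciprocal a
  descending≡reciprocal a = sum-cong-≗ {n} (λ i → cong (constant (a i) *_) (^ᵠ≡^ z (n ∸ toℕ i)))

  norm≡ : ∀ a → ascending z zⁿ≈1 (constant ∘ a) * descending z zⁿ≈1 (constant ∘ a) ≡ polynomial a * reciprocal a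
  norm≡ a = cong₂ _*_ (ascending≡polynomial a) (descending≡reciprocal a)

  -- Inverse of z modulo zⁿ - 1, so that evaluation at z⁻¹ induces p ↦ p* on the quotient.
  z⁻¹ : Poly
  z⁻¹ = z ^ᵠ ℕ.pred n

  open Evaluation 𝔽₂[z]/zⁿ-1 constant
    (isRingHomomorphism (λ {p} {q} {r} → Q.trans {p} {q} {r}) constant-homo projection-homo) z⁻¹

  -- Substituting z⁻¹ fixes the constant coefficients and turns zⁱ into zⁿ⁻ⁱ. The detour through
  -- `tabulate a` presents the power sum as a coefficient list, the form in which its value is
  -- known.
  evaluate-ascending : ∀ a → evaluate (ascending z zⁿ≈1 (constant ∘ a)) ≈[ n ] descending z zⁿ≈1 (constant ∘ a)
  evaluate-ascending a = begin
    evaluate (ascending z zⁿ≈1 (constant ∘ a))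
      ≡⟨ cong evaluate (ascending≡polynomial a) ⟩
    evaluate (polynomial a)
      ≈⟨ evaluate-cong (polynomial a) (tabulate a) (polynomial≗tabulate a) ⟩
    evaluate (tabulate a)
      ≈⟨ evaluate-tabulate a ⟩
    sum (λ i → constant (a i) * (z⁻¹ ^ᵠ toℕ i))
      ≈⟨ inverse-ascending z zⁿ≈1 (ℕ.suc-pred n) (constant ∘ a) ⟩
    descending z zⁿ≈1 (constant ∘ a) ∎
    where open import Relation.Binary.Reasoning.Setoid Q.setoid

  evaluate-quotient-homo : IsRingHomomorphism Q.rawRing Q.rawRing evaluate
  evaluate-quotient-homo = QuotientHomomorphism.quotient-homo 𝔽₂[z]-ring (z ^ n + - 1#) 𝔽₂[z]/zⁿ-1 evaluate-homo
    (evaluate-zⁿ-1 n z⁻ⁿ≈1)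
    where
    z⁻ⁿ≈1 : z⁻¹ ^ᵠ n ≈[ n ] 1#
    -- The boundary case i = n of `inverse-^`, whose right side is z⁰.
    z⁻ⁿ≈1 = Q.trans {z⁻¹ ^ᵠ n} {z ^ᵠ (n ∸ n)} {1#}
      (inverse-^ z zⁿ≈1 (ℕ.suc-pred n) n ℕ.≤-refl) (Q.reflexive (cong (z ^ᵠ_) (ℕ.n∸n≡0 n)))

  norm⇒symmetric : ∀ {h g} → polynomial h ≈[ n ] polynomial g * reciprocal g → Symmetric h
  norm⇒symmetric {h} {g} h≈gg* i _ = ≡.sym (polynomial-injective {a = h ∘ negate} {h} h⁻≈h i)
    where
    h⁻≈h : polynomial (h ∘ negate) ≈[ n ] polynomial h
    h⁻≈h = ≡.subst₂ _≈[ n ]_ (ascending≡polynomial (h ∘ negate)) (ascending≡polynomial h)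
      (norm-even z zⁿ≈1 evaluate evaluate-quotient-homo {constant ∘ h} {constant ∘ g}
        (evaluate-ascending h) (evaluate-ascending g) (evaluate-ascending (g ∘ negate))
        (≡.subst₂ _≈[ n ]_ (≡.sym (ascending≡polynomial h)) (≡.sym (norm≡ g)) h≈gg*))

  -- `doubleIndex h` is `h ∘ double` by definition, so this is `ascending-double-norm` at w = z.
  -- Characteristic 2 is checked coefficientwise, and idempotence of the coefficients comes from a²
  -- = a in 𝔽₂.
  doubleIndex-norm : n % 2 ≡ 1 → ∀ h → Symmetric h →
                     polynomial h ≈[ n ] polynomial (doubleIndex h) * reciprocal (doubleIndex h)
  doubleIndex-norm n-odd h h-sym =
    ≡.subst₂ _≈[ n ]_ (ascending≡polynomial h) (norm≡ (doubleIndex h))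
      (ascending-double-norm z zⁿ≈1 n-odd p+p≈0 (constant ∘ h)
        (λ i → ≈⇒≋ {constant (h i) * constant (h i)} {constant (h i)} (constant-idem (h i)))
        (λ i → Q.reflexive (cong constant (symmetric⇒even h-sym i))))
    where
    p+p≈0 : ∀ p → p + p ≈[ n ] []
    p+p≈0 p = ≈⇒≋ {p + p} {[]} (λ k → ≡.trans (coeff-+ p p k) (p+p≡0ℙ (coeff p k)))
    constant-idem : ∀ a → coeff (constant a * constant a) ≗ coeff (constant a)
    constant-idem a k = ≡.trans (≡.sym (IsRingHomomorphism.*-homo constant-homo a a k))
                                (cong (λ b → coeff (constant b) k) (*-idem a))

theorem4p1 : (n : ℕ) .{{_ : NonZero n}} → n % 2 ≡ 1 →
    ((h : Vector 𝔽₂ n) →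
    (∃ λ (g : Vector 𝔽₂ n) → polynomial h ≈[ n ] polynomial g * reciprocal g) ⇔ Symmetric h)
    × ((h : Vector 𝔽₂ n) → Symmetric h →
    polynomial h ≈[ n ] polynomial (doubleIndex h) * reciprocal (doubleIndex h))
theorem4p1 n n-odd =
    (λ h → mk⇔ (λ { (g , h≈gg*) → norm⇒symmetric n h≈gg* })
               (λ h-sym → doubleIndex h , doubleIndex-norm n n-odd h h-sym))
  , doubleIndex-norm n n-odd
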